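{- Let $\tilde L$ be a minimum-size counterexample. Let $L'\subseteq\tilde L$ be a subset which, with the order inherited from $\tilde L$, is a lattice (with least element $0_{L'}$ and greatest element $1_{L'}$), and suppose that at least one of the following holds: (i) $3<|L'|<8$; (ii) $2<|L'|<|\tilde L|-2$ and $d\le 1_{L'}$ for some dual atom $d$ of $\tilde L$. Then there exist $x\in L'\setminus\{0_{L'},1_{L'}\}$ and $y\in\tilde L\setminus L'$ such that, in $\tilde L$, $x$ upper covers $y$ or $x$ lower covers $y$.
   Context: For a poset $P$, $x$ upper covers $y$ (and $y$ lower covers $x$) if $y<x$ with nothing strictly between. Join-irreducible: upper covers exactly one element. A dual atom of a finite lattice is an element lower covered by... i.e. an element that the greatest element upper covers. For $x\in P$, ${\uparrow}x=\{y: x\le y\}$. A counterexample is a finite lattice $L$ with $|L|>1$ in which every join-irreducible $j$ satisfies $|{\uparrow}j|>|L|/2$; a minimum-size counterexample is a counterexample $\tilde L$ such that no counterexample has fewer elements. -}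

module Defs where

open import Data.Fin.Base using (Fin)
open import Data.Fin.Properties using (_≟_)
open import Data.Fin.Subset using (Subset; _∈_; ∣_∣)
open import Data.Nat.Base as ℕ using (ℕ)
open import Data.Product using (∃; ∃-syntax; ∃!; _×_; proj₁)
open import Data.Vec.Base using (tabulate)
open import Algebra.Core using (Op₂)
open import Function.Base using (_on_)
open import Level using (0ℓ)
open import Relation.Binary.Core using (Rel)
open import Relation.Binary.Definitions using (Decidable; Maximum)
open import Relation.Binary.Lattice.Bundles using (Lattice)
open import Relation.Binary.Lattice.Structures using (IsLattice; IsBoundedLattice)
open import Relation.Binary.PropositionalEquality.Core using (_≡_)
open import Relation.Nullary.Decidable.Core using (does)
open import Relation.Nullary.Negation.Core using (¬_)
import Relation.Binary.Construct.NonStrictToStrict as ToStrict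
import Relation.Binary.Lattice.Properties.MeetSemilattice as MeetSemilatticeProperties

-- A lattice with exactly n elements. Every finite lattice is isomorphic to one
-- carried by Fin n, and all the notions below are invariant under isomorphism.
record FiniteLattice (n : ℕ) : Set₁ where
  infix 4 _≤_
  field
    _≤_       : Rel (Fin n) 0ℓ
    _∨_       : Op₂ (Fin n)
    _∧_       : Op₂ (Fin n)
    isLattice : IsLattice _≡_ _≤_ _∨_ _∧_

  lattice : Lattice 0ℓ 0ℓ 0ℓ
  lattice = record { isLattice = isLattice }

  open Lattice lattice public using (meetSemilattice)
  open ToStrict _≡_ _≤_ public using (_<_)

  infix 4 _≤?_
  _≤?_ : Decidable _≤_
  _≤?_ = MeetSemilatticeProperties.≈-dec⇒≤-dec meetSemilattice _≟_

  infix 4 _UpperCovers_ _LowerCovers_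
  _UpperCovers_ : Rel (Fin n) 0ℓ
  x UpperCovers y = y < x × ¬ (∃[ z ] (y < z × z < x))

  _LowerCovers_ : Rel (Fin n) 0ℓ
  y LowerCovers x = x UpperCovers y

  JoinIrreducible : Fin n → Set
  JoinIrreducible j = ∃! _≡_ (j UpperCovers_)

  DualAtom : Fin n → Set
  DualAtom d = ∃[ t ] (Maximum _≤_ t × t UpperCovers d)

  infix 8 ↑_
  ↑_ : Fin n → Subset n
  ↑ x = tabulate (λ y → does (x ≤? y))

  -- The subset S, with the inherited order, is a lattice with the given
  -- operations and bounds. These need not agree with the joins, meets and bounds
  -- of the whole lattice, so S is not required to be a sublattice.
  IsBoundedLatticeOn : (S : Subset n) (_∨′_ _∧′_ : Op₂ (∃ (_∈ S)))
                       (1′ 0′ : ∃ (_∈ S)) → Set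
  IsBoundedLatticeOn S = IsBoundedLattice (_≡_ on proj₁) (_≤_ on proj₁)

-- The inequality |↑j| > |L|/2 is written without division as |L| < 2|↑j|.
IsCounterexample : ∀ {n} → FiniteLattice n → Set
IsCounterexample {n} L =
  1 ℕ.< n × (∀ j → JoinIrreducible j → n ℕ.< 2 ℕ.* ∣ ↑ j ∣)
  where open FiniteLattice L

IsMinimumCounterexample : ∀ {n} → FiniteLattice n → Set₁
IsMinimumCounterexample {n} L =
  IsCounterexample L ×
  (∀ {m} (K : FiniteLattice m) → IsCounterexample K → ¬ (m ℕ.< n))

{-# OPTIONS --safe #-}
module Submission where

-- If there are no such x and y, then the set I of inner elements of L′ is
-- connected to the rest of L only through b = 0′ and t = 1′. Hence I ∪ {b, t} and
-- the complement of I are both closed under joins and meets, and for j ∈ I the set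
-- ↑ j is the disjoint union of I ∩ ↑ j and ↑ t.
--   If some join-irreducible j ∈ I has 2 |I ∩ ↑ j| ≤ |I|, then |↑ j| > |L|/2 forces
-- |↑ t| > |L ∖ I|/2, and L ∖ I is a smaller counterexample. When t is not
-- join-irreducible in I ∪ {b, t} ≠ L, such a j exists because that lattice is not a
-- counterexample. When t covers only c there, either c itself is such a j (if
-- |I| ≥ 2), or c is not join-irreducible and takes the role of t. It remains to treat
-- |I| = 1 directly and to exclude counterexamples with 4 to 7 elements.

open import Defs
open import Algebra.Core using (Op₂)
open import Data.Fin.Subset using (Subset; _∈_; _∉_; ∣_∣)
open import Data.Nat.Base using (ℕ; _<_; _∸_)
open import Data.Product using (∃; ∃-syntax; _×_; proj₁)
open import Data.Sum.Base using (_⊎_)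
open import Relation.Binary.PropositionalEquality.Core using (_≢_)

open import Data.Bool.Base using (Bool; true; false)
open import Data.Empty using (⊥-elim)
open import Data.Fin.Base using (Fin; zero; suc)
open import Data.Fin.Induction using (po-wellFounded; po-noetherian)
open import Data.Fin.Properties using (_≟_; any?; suc-injective)
open import Data.Fin.Subset using (inside; outside; Empty; ⊤; ⊥; _⊆_; _∪_; _∩_; ∁; ⁅_⁆)
open import Data.Fin.Subset.Properties
open import Data.List.Base using (List; []; _∷_; length)
open import Data.List.Relation.Unary.All as All using (All; []; _∷_)
open import Data.List.Relation.Unary.AllPairs using ([]; _∷_)
open import Data.List.Relation.Unary.Unique.Propositional using (Unique)
open import Data.Nat.Base as ℕ using (z≤n; s≤s)
import Data.Nat.Properties as ℕₚ
open import Data.Product using (_,_; proj₂; map₂)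
open import Data.Sum.Base as Sum using (inj₁; inj₂; [_,_]′)
open import Data.Vec.Base using ([]; _∷_; tabulate; here; there)
open import Data.Vec.Properties using (lookup∘tabulate; []=⇒lookup; lookup⇒[]=; tabulate-cong)
open import Function.Base using (_∘_; flip)
open import Induction.WellFounded using (Acc; acc)
open import Relation.Binary.Lattice.Structures using (IsLattice; IsBoundedLattice)
import Relation.Binary.Construct.Flip.EqAndOrd as Flip
import Relation.Binary.Construct.NonStrictToStrict as ToStrict
open import Relation.Binary.PropositionalEquality
  using (_≡_; refl; sym; trans; cong; cong₂; subst; subst₂; ≢-sym; isEquivalence)
open import Relation.Nullary.Decidable.Core using (Dec; does; yes; no; _×-dec_; _⊎-dec_; ¬?)
open import Relation.Nullary.Decidable using (does-≡; dec-true; decidable-stable)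
open import Relation.Nullary.Negation.Core using (¬_; contradiction)

-- Cardinalities of subsets

private variable
  n : ℕ

∣p∪q∣+∣p∩q∣≡∣p∣+∣q∣ : (p q : Subset n) → ∣ p ∪ q ∣ ℕ.+ ∣ p ∩ q ∣ ≡ ∣ p ∣ ℕ.+ ∣ q ∣
∣p∪q∣+∣p∩q∣≡∣p∣+∣q∣ []            []            = refl
∣p∪q∣+∣p∩q∣≡∣p∣+∣q∣ (inside  ∷ p) (inside  ∷ q) = cong ℕ.suc
  (trans (ℕₚ.+-suc _ _) (trans (cong ℕ.suc (∣p∪q∣+∣p∩q∣≡∣p∣+∣q∣ p q)) (sym (ℕₚ.+-suc _ _))))
∣p∪q∣+∣p∩q∣≡∣p∣+∣q∣ (inside  ∷ p) (outside ∷ q) = cong ℕ.suc (∣p∪q∣+∣p∩q∣≡∣p∣+∣q∣ p q)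
∣p∪q∣+∣p∩q∣≡∣p∣+∣q∣ (outside ∷ p) (inside  ∷ q) =
  trans (cong ℕ.suc (∣p∪q∣+∣p∩q∣≡∣p∣+∣q∣ p q)) (sym (ℕₚ.+-suc _ _))
∣p∪q∣+∣p∩q∣≡∣p∣+∣q∣ (outside ∷ p) (outside ∷ q) = ∣p∪q∣+∣p∩q∣≡∣p∣+∣q∣ p q

cover⇒∣r∣≤∣p∣+∣q∣ : {p q r : Subset n} → (∀ {x} → x ∈ r → x ∈ p ⊎ x ∈ q) →
                    ∣ r ∣ ℕ.≤ ∣ p ∣ ℕ.+ ∣ q ∣
cover⇒∣r∣≤∣p∣+∣q∣ {p = p} {q} {r} r⊆ = begin
  ∣ r ∣                      ≤⟨ p⊆q⇒∣p∣≤∣q∣ (x∈p∪q⁺ ∘ r⊆) ⟩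
  ∣ p ∪ q ∣                  ≤⟨ ℕₚ.m≤m+n _ _ ⟩
  ∣ p ∪ q ∣ ℕ.+ ∣ p ∩ q ∣    ≡⟨ ∣p∪q∣+∣p∩q∣≡∣p∣+∣q∣ p q ⟩
  ∣ p ∣ ℕ.+ ∣ q ∣            ∎
  where open ℕₚ.≤-Reasoning

disjoint⇒∣p∣+∣q∣≤∣r∣ : {p q r : Subset n} → p ⊆ r → q ⊆ r → (∀ {x} → x ∈ p → x ∉ q) →
                       ∣ p ∣ ℕ.+ ∣ q ∣ ℕ.≤ ∣ r ∣
disjoint⇒∣p∣+∣q∣≤∣r∣ {n = n} {p} {q} {r} p⊆r q⊆r disjoint = begin
  ∣ p ∣ ℕ.+ ∣ q ∣            ≡⟨ ∣p∪q∣+∣p∩q∣≡∣p∣+∣q∣ p q ⟨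
  ∣ p ∪ q ∣ ℕ.+ ∣ p ∩ q ∣    ≡⟨ cong (λ s → ∣ p ∪ q ∣ ℕ.+ ∣ s ∣) (Empty-unique empty) ⟩
  ∣ p ∪ q ∣ ℕ.+ ∣ ⊥ {n} ∣ ≡⟨ cong (∣ p ∪ q ∣ ℕ.+_) (∣⊥∣≡0 n) ⟩
  ∣ p ∪ q ∣ ℕ.+ 0            ≡⟨ ℕₚ.+-identityʳ _ ⟩
  ∣ p ∪ q ∣                  ≤⟨ p⊆q⇒∣p∣≤∣q∣ (λ x∈ → [ p⊆r , q⊆r ]′ (x∈p∪q⁻ p q x∈)) ⟩
  ∣ r ∣                      ∎
  where
  open ℕₚ.≤-Reasoning
  empty : Empty (p ∩ q)
  empty (x , x∈) = let x∈p , x∈q = x∈p∩q⁻ p q x∈ in disjoint x∈p x∈q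

∣p∣+∣∁p∣≡n : (p : Subset n) → ∣ p ∣ ℕ.+ ∣ ∁ p ∣ ≡ n
∣p∣+∣∁p∣≡n p = trans (cong (∣ p ∣ ℕ.+_) (∣∁p∣≡n∸∣p∣ p)) (ℕₚ.m+[n∸m]≡n (∣p∣≤n p))

p⊆⁅x⁆⇒∣p∣≤1 : {p : Subset n} (x : Fin n) → (∀ {y} → y ∈ p → y ≡ x) → ∣ p ∣ ℕ.≤ 1
p⊆⁅x⁆⇒∣p∣≤1 x p⊆ = subst (_ ℕ.≤_) (∣⁅x⁆∣≡1 x)
  (p⊆q⇒∣p∣≤∣q∣ (λ y∈p → subst (_∈ ⁅ x ⁆) (sym (p⊆ y∈p)) (x∈⁅x⁆ x)))

∣⁅x⁆∣+∣⁅y⁆∣≡2 : (x y : Fin n) → ∣ ⁅ x ⁆ ∣ ℕ.+ ∣ ⁅ y ⁆ ∣ ≡ 2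
∣⁅x⁆∣+∣⁅y⁆∣≡2 x y = cong₂ ℕ._+_ (∣⁅x⁆∣≡1 x) (∣⁅x⁆∣≡1 y)

-- Lower bounds on cardinalities are obtained below by listing distinct members. Deleting the head
-- from `p` keeps the rest of the list inside.
unique⇒length≤∣p∣ : {p : Subset n} {xs : List (Fin n)} → Unique xs → All (_∈ p) xs →
                    length xs ℕ.≤ ∣ p ∣
unique⇒length≤∣p∣ []          []            = z≤n
unique⇒length≤∣p∣ (x≢xs ∷ us) (x∈p ∷ xs⊆p) = ℕₚ.≤-<-trans
  (unique⇒length≤∣p∣ us
    (All.zipWith (λ (x≢y , y∈p) → x∈p∧x≢y⇒x∈p-y y∈p (≢-sym x≢y)) (x≢xs , xs⊆p)))
  (x∈p⇒∣p-x∣<∣p∣ x∈p)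

0<∣p∣⇒nonempty : {p : Subset n} → 0 ℕ.< ∣ p ∣ → ∃ (_∈ p)
0<∣p∣⇒nonempty {n = n} {p} 0<∣p∣ with nonempty? p
... | yes p≠∅ = p≠∅
... | no  p=∅ = contradiction
  (trans (cong ∣_∣ (Empty-unique p=∅)) (∣⊥∣≡0 n)) (ℕₚ.>⇒≢ 0<∣p∣)

-- Enumerating the members of a subset

index : (S : Subset n) → Fin ∣ S ∣ → Fin n
index (inside  ∷ S) zero    = zero
index (inside  ∷ S) (suc i) = suc (index S i)
index (outside ∷ S) i       = suc (index S i)

index∈ : (S : Subset n) (i : Fin ∣ S ∣) → index S i ∈ S
index∈ (inside  ∷ S) zero    = here
index∈ (inside  ∷ S) (suc i) = there (index∈ S i)
index∈ (outside ∷ S) i       = there (index∈ S i)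

index-injective : (S : Subset n) {i j : Fin ∣ S ∣} → index S i ≡ index S j → i ≡ j
index-injective (inside  ∷ S) {zero}  {zero}  eq = refl
index-injective (inside  ∷ S) {suc i} {suc j} eq = cong suc (index-injective S (suc-injective eq))
index-injective (outside ∷ S)                 eq = index-injective S (suc-injective eq)

position : {S : Subset n} {x : Fin n} → x ∈ S → Fin ∣ S ∣
position {S = inside  ∷ S} here        = zero
position {S = inside  ∷ S} (there x∈S) = suc (position x∈S)
position {S = outside ∷ S} (there x∈S) = position x∈S

index-position : {S : Subset n} {x : Fin n} (x∈S : x ∈ S) → index S (position x∈S) ≡ x
index-position {S = inside  ∷ S} here        = refl
index-position {S = inside  ∷ S} (there x∈S) = cong suc (index-position x∈S)
index-position {S = outside ∷ S} (there x∈S) = cong suc (index-position x∈S)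

-- Compares an up-set taken inside a sublattice, which is tabulated along `index S`, with an up-set
-- of the whole lattice.
∣tabulate∘index∣ : (S : Subset n) (f : Fin n → Bool) →
                   ∣ tabulate (f ∘ index S) ∣ ≡ ∣ S ∩ tabulate f ∣
∣tabulate∘index∣ []            f = refl
∣tabulate∘index∣ (inside  ∷ S) f with f zero
... | true  = cong ℕ.suc (∣tabulate∘index∣ S (f ∘ suc))
... | false = ∣tabulate∘index∣ S (f ∘ suc)
∣tabulate∘index∣ (outside ∷ S) f = ∣tabulate∘index∣ S (f ∘ suc)

-- Finite lattices

dual : FiniteLattice n → FiniteLattice n
dual L = record
  { _≤_       = flip _≤_
  ; _∨_       = _∧_
  ; _∧_       = _∨_
  ; isLattice = record
    { isPartialOrder = Flip.isPartialOrder isPartialOrder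
    ; supremum       = infimum
    ; infimum        = supremum
    }
  }
  where
  open FiniteLattice L
  open IsLattice isLattice

module Order (L : FiniteLattice n) where

  open FiniteLattice L public renaming (_<_ to _≺_)
  open IsLattice isLattice public
    using (isPartialOrder; antisym; x≤x∨y; y≤x∨y; ∨-least; x∧y≤x; x∧y≤y; ∧-greatest)
    renaming (refl to ≤-refl; reflexive to ≤-reflexive; trans to ≤-trans)

  infix 4 _≺?_
  _≺?_ : ∀ x y → Dec (x ≺ y)
  _≺?_ = ToStrict.<-decidable _≡_ _≤_ _≟_ _≤?_

  ≺⇒≤ : ∀ {x y} → x ≺ y → x ≤ y
  ≺⇒≤ = proj₁

  ≺⇒≱ : ∀ {x y} → x ≺ y → ¬ (y ≤ x)
  ≺⇒≱ = ToStrict.<⇒≱ _≡_ _≤_ antisym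

  ≤⇒≺⊎≡ : ∀ {x y} → x ≤ y → x ≺ y ⊎ x ≡ y
  ≤⇒≺⊎≡ {x} {y} x≤y with x ≟ y
  ... | yes x≡y = inj₂ x≡y
  ... | no  x≢y = inj₁ (x≤y , x≢y)

  ∈↑⁺ : ∀ {x y} → x ≤ y → y ∈ ↑ x
  ∈↑⁺ {x} {y} x≤y = lookup⇒[]= y (↑ x) (trans (lookup∘tabulate _ y) (dec-true (x ≤? y) x≤y))

  ∈↑⁻ : ∀ {x y} → y ∈ ↑ x → x ≤ y
  ∈↑⁻ {x} {y} y∈↑x with x ≤? y | trans (sym (lookup∘tabulate (λ y → does (x ≤? y)) y)) ([]=⇒lookup y∈↑x)
  ... | yes x≤y | _ = x≤y

  infix 4 _upperCovers?_
  _upperCovers?_ : ∀ x y → Dec (x UpperCovers y)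
  x upperCovers? y = y ≺? x ×-dec ¬? (any? λ z → y ≺? z ×-dec z ≺? x)

  -- In a finite lattice such a `c` exists exactly when `j` is join-irreducible, and is then its
  -- only lower cover. Unlike the cover relation, this form is easily relativised to a subset.
  IsPredecessor : Fin n → Fin n → Set
  IsPredecessor c j = c ≺ j × (∀ {y} → y ≺ j → y ≤ c)

  -- Climb from `x` to an element strictly between as long as there is one; finiteness stops the
  -- climb at a lower cover of `y`.
  lowerCoverAbove : ∀ {x y} → x ≺ y → ∃[ z ] (x ≤ z × y UpperCovers z)
  lowerCoverAbove {x} {y} = go x (po-noetherian isPartialOrder x)
    where
    go : ∀ x → Acc (flip _≺_) x → x ≺ y → ∃[ z ] (x ≤ z × y UpperCovers z)
    go x (acc rec) x≺y with any? (λ z → x ≺? z ×-dec z ≺? y)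
    ... | no  none            = x , ≤-refl , x≺y , none
    ... | yes (z , x≺z , z≺y) =
      let w , z≤w , covers = go z (rec x≺z) z≺y in w , ≤-trans (≺⇒≤ x≺z) z≤w , covers

  minimal : ∀ {P : Fin n → Set} → (∀ x → Dec (P x)) → ∀ {x} → P x →
            ∃[ y ] (P y × (∀ {z} → z ≺ y → ¬ P z))
  minimal {P} P? {x} = go x (po-wellFounded isPartialOrder x)
    where
    go : ∀ x → Acc _≺_ x → P x → ∃[ y ] (P y × (∀ {z} → z ≺ y → ¬ P z))
    go x (acc rec) Px with any? (λ z → z ≺? x ×-dec P? z)
    ... | yes (z , z≺x , Pz) = go z (rec z≺x) Pz
    ... | no  none           = x , Px , λ z≺x Pz → none (_ , z≺x , Pz)

  predecessor⇒joinIrreducible : ∀ {c j} → IsPredecessor c j → JoinIrreducible j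
  predecessor⇒joinIrreducible {c} (c≺j , below) =
    c , (c≺j , λ (z , c≺z , z≺j) → ≺⇒≱ c≺z (below z≺j)) , unique
    where
    unique : ∀ {y} → _ UpperCovers y → c ≡ y
    unique (y≺j , none) with ≤⇒≺⊎≡ (below y≺j)
    ... | inj₁ y≺c = contradiction (_ , y≺c , c≺j) none
    ... | inj₂ y≡c = sym y≡c

  -- Whatever is strictly below `j` lies below some lower cover of `j`, and `c` is the only one.
  joinIrreducible⇒predecessor : ∀ {j} → JoinIrreducible j → ∃[ c ] IsPredecessor c j
  joinIrreducible⇒predecessor (c , (c≺j , _) , unique) = c , c≺j , λ y≺j →
    let z , y≤z , covers = lowerCoverAbove y≺j in subst (_ ≤_) (sym (unique covers)) y≤z

  dualAtom≤ : ∀ {d t} → (∀ x → x ≤ t) → t UpperCovers d →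
              ∀ {y} → d ≤ y → y ∈ ⁅ d ⁆ ⊎ y ∈ ⁅ t ⁆
  dualAtom≤ t-max (_ , none) {y} d≤y with ≤⇒≺⊎≡ d≤y | ≤⇒≺⊎≡ (t-max y)
  ... | inj₂ refl | _         = inj₁ (x∈⁅x⁆ _)
  ... | inj₁ _    | inj₂ refl = inj₂ (x∈⁅x⁆ _)
  ... | inj₁ d≺y  | inj₁ y≺t  = contradiction (y , d≺y , y≺t) none

  dualAtom≤⇒∣↑∣≤2 : ∀ {d x} → DualAtom d → d ≤ x → ∣ ↑ x ∣ ℕ.≤ 2
  dualAtom≤⇒∣↑∣≤2 {d} {x} (t , t-max , covers) d≤x = subst (∣ ↑ x ∣ ℕ.≤_)
    (∣⁅x⁆∣+∣⁅y⁆∣≡2 d t)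
    (cover⇒∣r∣≤∣p∣+∣q∣ λ y∈↑x → dualAtom≤ t-max covers (≤-trans d≤x (∈↑⁻ y∈↑x)))

  -- The hypothesis concerns single covers. Descend by covers from `i` towards `y`: either the
  -- descent stays in `I`, or its first exit is below `b`, and then so is `y`.
  propagateDown : ∀ {I : Subset n} {b} →
    (∀ {i z} → i ∈ I → i UpperCovers z → z ∈ I ⊎ z ≤ b) →
    ∀ {i y} → i ∈ I → y ≤ i → y ∈ I ⊎ y ≤ b
  propagateDown {I} {b} step {i} = go i (po-wellFounded isPartialOrder i)
    where
    go : ∀ i → Acc _≺_ i → ∀ {y} → i ∈ I → y ≤ i → y ∈ I ⊎ y ≤ b
    go i (acc rec) i∈I y≤i with ≤⇒≺⊎≡ y≤i
    ... | inj₂ refl = inj₁ i∈I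
    ... | inj₁ y≺i with lowerCoverAbove y≺i
    ...   | z , y≤z , covers with step i∈I covers
    ...     | inj₁ z∈I = go z (rec (proj₁ covers)) z∈I y≤z
    ...     | inj₂ z≤b = inj₂ (≤-trans y≤z z≤b)

  -- The operations are those of `L`, so a closed subset is a sublattice; the subset in the theorem
  -- need not be one.
  Closed : Subset n → Set
  Closed S = ∀ {x y} → x ∈ S → y ∈ S → (x ∨ y) ∈ S × (x ∧ y) ∈ S

dual-upperCovers : ∀ {L : FiniteLattice n} {x y} →
  FiniteLattice._UpperCovers_ (dual L) x y → FiniteLattice._LowerCovers_ L x y
dual-upperCovers (y≺x , none) = map₂ ≢-sym y≺x ,
  λ (z , x≺z , z≺y) → none (z , map₂ ≢-sym z≺y , map₂ ≢-sym x≺z)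

-- Sublattices as finite lattices

module Restriction (L : FiniteLattice n) {S : Subset n} (closed : Order.Closed L S) where

  open Order L

  private
    join meet : Op₂ (Fin ∣ S ∣)
    join i j = position (proj₁ (closed (index∈ S i) (index∈ S j)))
    meet i j = position (proj₂ (closed (index∈ S i) (index∈ S j)))

    index-join : ∀ i j → index S (join i j) ≡ index S i ∨ index S j
    index-join i j = index-position (proj₁ (closed (index∈ S i) (index∈ S j)))

    index-meet : ∀ i j → index S (meet i j) ≡ index S i ∧ index S j
    index-meet i j = index-position (proj₂ (closed (index∈ S i) (index∈ S j)))

  restrict : FiniteLattice ∣ S ∣
  restrict = record
    { _≤_       = λ i j → index S i ≤ index S j
    ; _∨_       = join
    ; _∧_       = meet
    ; isLattice = record
      { isPartialOrder = record
        { isPreorder = record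
          { isEquivalence = isEquivalence
          ; reflexive     = ≤-reflexive ∘ cong (index S)
          ; trans         = ≤-trans
          }
        ; antisym = λ x≤y y≤x → index-injective S (antisym x≤y y≤x)
        }
      ; supremum = λ i j →
          subst (index S i ≤_) (sym (index-join i j)) (x≤x∨y _ _) ,
          subst (index S j ≤_) (sym (index-join i j)) (y≤x∨y _ _) ,
          λ k i≤k j≤k → subst (_≤ index S k) (sym (index-join i j)) (∨-least i≤k j≤k)
      ; infimum = λ i j →
          subst (_≤ index S i) (sym (index-meet i j)) (x∧y≤x _ _) ,
          subst (_≤ index S j) (sym (index-meet i j)) (x∧y≤y _ _) ,
          λ k k≤i k≤j → subst (index S k ≤_) (sym (index-meet i j)) (∧-greatest k≤i k≤j)
      }
    }

  private module R = Order restrict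

  ∣↑∣-restrict : ∀ i → ∣ R.↑ i ∣ ≡ ∣ S ∩ ↑ (index S i) ∣
  ∣↑∣-restrict i = trans
    -- The two deciders are different terms for the same proposition, so only their truth values
    -- agree.
    (cong ∣_∣ (tabulate-cong λ j → does-≡ (i R.≤? j) (index S i ≤? index S j)))
    (∣tabulate∘index∣ S (λ y → does (index S i ≤? y)))

  index-predecessor : ∀ {c j} → R.IsPredecessor c j →
    index S c ≺ index S j × (∀ {y} → y ∈ S → y ≺ index S j → y ≤ index S c)
  index-predecessor {c} {j} ((c≤j , c≢j) , below) =
    (c≤j , c≢j ∘ index-injective S) , λ {y} y∈S (y≤j , y≢j) →
      subst (_≤ index S c) (index-position y∈S)
        (below ( subst (_≤ index S j) (sym (index-position y∈S)) y≤j
               , λ eq → y≢j (trans (sym (index-position y∈S)) (cong (index S) eq))))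

  -- Moves the condition from `Fin ∣ S ∣` to members of `S` inside `L`. Here `c` is a predecessor of
  -- `j` relative to `S` only, so `j` may fail to be join-irreducible in `L`.
  restrict-counterexample : 1 ℕ.< ∣ S ∣ →
    (∀ {c j} → c ∈ S → j ∈ S → c ≺ j → (∀ {y} → y ∈ S → y ≺ j → y ≤ c) →
      ∣ S ∣ ℕ.< 2 ℕ.* ∣ S ∩ ↑ j ∣) →
    IsCounterexample restrict
  restrict-counterexample 1<∣S∣ large = 1<∣S∣ , λ j irreducible →
    let c , predecessor = R.joinIrreducible⇒predecessor irreducible
        c≺j , below     = index-predecessor predecessor
    in subst (λ k → ∣ S ∣ ℕ.< 2 ℕ.* k) (sym (∣↑∣-restrict j))
         (large (index∈ S c) (index∈ S j) c≺j below)

-- Subsets attached to the rest through two elements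

-- A path of covers from a member of I to an element outside I passes through b or t.
record IsInterior (L : FiniteLattice n) (I : Subset n) (b t : Fin n) : Set where
  open Order L
  field
    b≺t  : b ≺ t
    b≺   : ∀ {i} → i ∈ I → b ≺ i
    ≺t   : ∀ {i} → i ∈ I → i ≺ t
    up   : ∀ {i y} → i ∈ I → i ≤ y → y ∈ I ⊎ t ≤ y
    down : ∀ {i y} → i ∈ I → y ≤ i → y ∈ I ⊎ y ≤ b

  b∉I : b ∉ I
  b∉I b∈I = ≺⇒≱ (b≺ b∈I) ≤-refl

  t∉I : t ∉ I
  t∉I t∈I = ≺⇒≱ (≺t t∈I) ≤-refl

-- Lets every statement on meets follow from the one on joins.
IsInterior-dual : ∀ {L : FiniteLattice n} {I b t} → IsInterior L I b t → IsInterior (dual L) I t b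
IsInterior-dual interior = record
  { b≺t  = map₂ ≢-sym b≺t
  ; b≺   = map₂ ≢-sym ∘ ≺t
  ; ≺t   = map₂ ≢-sym ∘ b≺
  ; up   = down
  ; down = up
  }
  where open IsInterior interior

withBounds : Subset n → Fin n → Fin n → Subset n
withBounds I b t = I ∪ (⁅ b ⁆ ∪ ⁅ t ⁆)

module _ {I : Subset n} {b t : Fin n} where

  withBounds⁺ : ∀ {x} → x ∈ I ⊎ (x ≡ b ⊎ x ≡ t) → x ∈ withBounds I b t
  withBounds⁺ = x∈p∪q⁺ ∘ Sum.map₂ (x∈p∪q⁺ ∘ Sum.map (λ { refl → x∈⁅x⁆ b }) (λ { refl → x∈⁅x⁆ t }))

  withBounds⁻ : ∀ {x} → x ∈ withBounds I b t → x ∈ I ⊎ (x ≡ b ⊎ x ≡ t)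
  withBounds⁻ = Sum.map₂ (Sum.map (x∈⁅y⁆⇒x≡y b) (x∈⁅y⁆⇒x≡y t) ∘ x∈p∪q⁻ _ _) ∘ x∈p∪q⁻ _ _

  ∣withBounds∣≤ : ∣ withBounds I b t ∣ ℕ.≤ ∣ I ∣ ℕ.+ 2
  ∣withBounds∣≤ = ℕₚ.≤-trans (cover⇒∣r∣≤∣p∣+∣q∣ (x∈p∪q⁻ I _))
    (ℕₚ.+-monoʳ-≤ ∣ I ∣ (ℕₚ.≤-trans (cover⇒∣r∣≤∣p∣+∣q∣ (x∈p∪q⁻ ⁅ b ⁆ ⁅ t ⁆))
      (ℕₚ.≤-reflexive (∣⁅x⁆∣+∣⁅y⁆∣≡2 b t))))

  withBounds-⊆ : {S : Subset n} → I ⊆ S → b ∈ S → t ∈ S → withBounds I b t ⊆ S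
  withBounds-⊆ I⊆S b∈S t∈S = [ I⊆S , [ (λ { refl → b∈S }) , (λ { refl → t∈S }) ]′ ]′ ∘ withBounds⁻

module JoinClosure {L : FiniteLattice n} {I b t} (interior : IsInterior L I b t) where

  open Order L
  open IsInterior interior

  -- A join with a member of `I` is in `I` or above `t` by `up`; being also below `t`, in the latter
  -- case it is `t`.
  ∨-withBounds : ∀ {x y} → x ∈ I ⊎ (x ≡ b ⊎ x ≡ t) → y ∈ I ⊎ (y ≡ b ⊎ y ≡ t) →
                 (x ∨ y) ∈ I ⊎ ((x ∨ y) ≡ b ⊎ (x ∨ y) ≡ t)
  ∨-withBounds {x} {y} x∈ y∈ = result x∈
    where
    b≤ : ∀ {z} → z ∈ I ⊎ (z ≡ b ⊎ z ≡ t) → b ≤ z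
    b≤ = [ ≺⇒≤ ∘ b≺ , [ ≤-reflexive ∘ sym , (λ { refl → ≺⇒≤ b≺t }) ]′ ]′

    ≤t : ∀ {z} → z ∈ I ⊎ (z ≡ b ⊎ z ≡ t) → z ≤ t
    ≤t = [ ≺⇒≤ ∘ ≺t , [ (λ { refl → ≺⇒≤ b≺t }) , ≤-reflexive ]′ ]′

    ∨≤t : x ∨ y ≤ t
    ∨≤t = ∨-least (≤t x∈) (≤t y∈)

    result : x ∈ I ⊎ (x ≡ b ⊎ x ≡ t) → (x ∨ y) ∈ I ⊎ ((x ∨ y) ≡ b ⊎ (x ∨ y) ≡ t)
    result (inj₁ x∈I) = Sum.map₂ (inj₂ ∘ antisym ∨≤t) (up x∈I (x≤x∨y x y))
    result (inj₂ (inj₁ refl)) = subst (λ z → z ∈ I ⊎ (z ≡ b ⊎ z ≡ t))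
      (antisym (y≤x∨y x y) (∨-least (b≤ y∈) ≤-refl)) y∈
    result (inj₂ (inj₂ refl)) = inj₂ (inj₂ (antisym ∨≤t (x≤x∨y x y)))

  -- Were the join in `I`, then `down` would put `x` and `y` below `b`, hence also the join,
  -- although members of `I` are strictly above `b`.
  ∨-∁ : ∀ {x y} → x ∉ I → y ∉ I → (x ∨ y) ∉ I
  ∨-∁ {x} {y} x∉I y∉I x∨y∈I = ≺⇒≱ (b≺ x∨y∈I) (∨-least
    ([ flip contradiction x∉I , (λ x≤b → x≤b) ]′ (down x∨y∈I (x≤x∨y x y)))
    ([ flip contradiction y∉I , (λ y≤b → y≤b) ]′ (down x∨y∈I (y≤x∨y x y))))

module Interior {L : FiniteLattice n} {I b t} (interior : IsInterior L I b t) where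

  open Order L
  open IsInterior interior public

  private
    module Join = JoinClosure interior
    module Meet = JoinClosure (IsInterior-dual interior)

  b≤ : ∀ {x} → x ∈ withBounds I b t → b ≤ x
  b≤ x∈S with withBounds⁻ x∈S
  ... | inj₁ x∈I         = ≺⇒≤ (b≺ x∈I)
  ... | inj₂ (inj₁ refl) = ≤-refl
  ... | inj₂ (inj₂ refl) = ≺⇒≤ b≺t

  withBounds-closed : Closed (withBounds I b t)
  withBounds-closed x∈ y∈ =
    withBounds⁺ (Join.∨-withBounds (withBounds⁻ x∈) (withBounds⁻ y∈)) ,
    withBounds⁺ (Sum.map₂ Sum.swap
      (Meet.∨-withBounds (Sum.map₂ Sum.swap (withBounds⁻ x∈)) (Sum.map₂ Sum.swap (withBounds⁻ y∈))))

  ∁-closed : Closed (∁ I)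
  ∁-closed x∈ y∈ =
    x∉p⇒x∈∁p (Join.∨-∁ (x∈∁p⇒x∉p x∈) (x∈∁p⇒x∉p y∈)) ,
    x∉p⇒x∈∁p (Meet.∨-∁ (x∈∁p⇒x∉p x∈) (x∈∁p⇒x∉p y∈))

  -- A greatest element `c` of `I` can replace `t`: since `c ≺ t`, every way up out of the other
  -- members of `I` ends above `c`.
  interiorBelow : ∀ {c} → c ∈ I → (∀ {x} → x ∈ I → x ≤ c) → IsInterior L (I ∩ ∁ ⁅ c ⁆) b c
  interiorBelow {c} c∈I ≤c = record
    { b≺t  = b≺ c∈I
    ; b≺   = b≺ ∘ ∈I
    ; ≺t   = λ i∈ → ≤c (∈I i∈) , ≢c i∈
    ; up   = λ i∈ i≤y → up′ (up (∈I i∈) i≤y)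
    ; down = λ i∈ y≤i → Sum.map₁
               (λ y∈I → ∈I∖c y∈I λ { refl → ≢c i∈ (antisym (≤c (∈I i∈)) y≤i) })
               (down (∈I i∈) y≤i)
    }
    where
    ∈I : ∀ {x} → x ∈ I ∩ ∁ ⁅ c ⁆ → x ∈ I
    ∈I = p∩q⊆p I (∁ ⁅ c ⁆)

    ≢c : ∀ {x} → x ∈ I ∩ ∁ ⁅ c ⁆ → x ≢ c
    ≢c x∈ refl = x∈∁p⇒x∉p (p∩q⊆q I (∁ ⁅ c ⁆) x∈) (x∈⁅x⁆ c)

    ∈I∖c : ∀ {x} → x ∈ I → x ≢ c → x ∈ I ∩ ∁ ⁅ c ⁆
    ∈I∖c x∈I x≢c = x∈p∩q⁺ (x∈I , x∉p⇒x∈∁p (x≢c ∘ x∈⁅y⁆⇒x≡y c))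

    up′ : ∀ {y} → y ∈ I ⊎ t ≤ y → y ∈ I ∩ ∁ ⁅ c ⁆ ⊎ c ≤ y
    up′ {y} (inj₂ t≤y) = inj₂ (≤-trans (≺⇒≤ (≺t c∈I)) t≤y)
    up′ {y} (inj₁ y∈I) with y ≟ c
    ... | yes refl = inj₂ ≤-refl
    ... | no  y≢c  = inj₁ (∈I∖c y∈I y≢c)

-- Consequences of minimality

module Minimum (L : FiniteLattice n) (minimum : IsMinimumCounterexample L) where

  open Order L

  large : ∀ {c j} → IsPredecessor c j → n ℕ.< 2 ℕ.* ∣ ↑ j ∣
  large predecessor = proj₂ (proj₁ minimum) _ (predecessor⇒joinIrreducible predecessor)

  noSmallerCounterexample : ∀ {S} → Closed S → 1 ℕ.< ∣ S ∣ → ∣ S ∣ ℕ.< n →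
    ¬ (∀ {c j} → c ∈ S → j ∈ S → c ≺ j → (∀ {y} → y ∈ S → y ≺ j → y ≤ c) →
        ∣ S ∣ ℕ.< 2 ℕ.* ∣ S ∩ ↑ j ∣)
  noSmallerCounterexample closed 1<∣S∣ ∣S∣<n S-large = proj₂ minimum
    restrict (restrict-counterexample 1<∣S∣ S-large) ∣S∣<n
    where open Restriction L closed

  -- By the hypothesis on j, more than half of ∁ I lies above t; so ∁ I is a
  -- counterexample, since the up-set of a join-irreducible not below t avoids I.
  noSmallUpset : ∀ {I b t c j} → IsInterior L I b t → j ∈ I → IsPredecessor c j →
                 ¬ (2 ℕ.* ∣ I ∩ ↑ j ∣ ℕ.≤ ∣ I ∣)
  noSmallUpset {I} {b} {t} {j = j} interior j∈I predecessor small =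
    noSmallerCounterexample ∁-closed 1<∣∁I∣ ∣∁I∣<n ∁I-large
    where
    open Interior interior
    open ℕₚ.≤-Reasoning

    ∣∁I∣<2∣↑t∣ : ∣ ∁ I ∣ ℕ.< 2 ℕ.* ∣ ↑ t ∣
    ∣∁I∣<2∣↑t∣ = ℕₚ.+-cancelˡ-< ∣ I ∣ _ _ (begin-strict
      ∣ I ∣ ℕ.+ ∣ ∁ I ∣                        ≡⟨ ∣p∣+∣∁p∣≡n I ⟩
      n                                        <⟨ large predecessor ⟩
      2 ℕ.* ∣ ↑ j ∣                            ≤⟨ ℕₚ.*-monoʳ-≤ 2 (cover⇒∣r∣≤∣p∣+∣q∣ split) ⟩
      2 ℕ.* (∣ I ∩ ↑ j ∣ ℕ.+ ∣ ↑ t ∣)          ≡⟨ ℕₚ.*-distribˡ-+ 2 ∣ I ∩ ↑ j ∣ ∣ ↑ t ∣ ⟩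
      2 ℕ.* ∣ I ∩ ↑ j ∣ ℕ.+ 2 ℕ.* ∣ ↑ t ∣      ≤⟨ ℕₚ.+-monoˡ-≤ _ small ⟩
      ∣ I ∣ ℕ.+ 2 ℕ.* ∣ ↑ t ∣                  ∎)
      where
      split : ∀ {x} → x ∈ ↑ j → x ∈ I ∩ ↑ j ⊎ x ∈ ↑ t
      split x∈↑j = Sum.map (λ x∈I → x∈p∩q⁺ (x∈I , x∈↑j)) ∈↑⁺ (up j∈I (∈↑⁻ x∈↑j))

    1<∣∁I∣ : 1 ℕ.< ∣ ∁ I ∣
    1<∣∁I∣ = unique⇒length≤∣p∣ ((proj₂ b≺t ∷ []) ∷ [] ∷ [])
      (x∉p⇒x∈∁p b∉I ∷ x∉p⇒x∈∁p t∉I ∷ [])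

    ∣∁I∣<n : ∣ ∁ I ∣ ℕ.< n
    ∣∁I∣<n = subst (∣ ∁ I ∣ ℕ.<_) (∣p∣+∣∁p∣≡n I)
      (ℕₚ.+-monoˡ-≤ ∣ ∁ I ∣ (unique⇒length≤∣p∣ ([] ∷ []) (j∈I ∷ [])))

    ∁I-large : ∀ {c k} → c ∈ ∁ I → k ∈ ∁ I → c ≺ k → (∀ {y} → y ∈ ∁ I → y ≺ k → y ≤ c) →
               ∣ ∁ I ∣ ℕ.< 2 ℕ.* ∣ ∁ I ∩ ↑ k ∣
    ∁I-large {c} {k} c∈ k∈ c≺k c-max with k ≤? t
    ... | yes k≤t = ℕₚ.<-≤-trans ∣∁I∣<2∣↑t∣ (ℕₚ.*-monoʳ-≤ 2 (p⊆q⇒∣p∣≤∣q∣ λ z∈↑t →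
          x∈p∩q⁺ ( x∉p⇒x∈∁p (λ z∈I → ≺⇒≱ (≺t z∈I) (∈↑⁻ z∈↑t))
                 , ∈↑⁺ (≤-trans k≤t (∈↑⁻ z∈↑t)))))
    ... | no k≰t = ℕₚ.<-trans ∣∁I∣<n (ℕₚ.<-≤-trans (large (c≺k , λ {y} → c-max′ {y}))
          (ℕₚ.*-monoʳ-≤ 2 (p⊆q⇒∣p∣≤∣q∣ λ z∈↑k →
            x∈p∩q⁺ ( x∉p⇒x∈∁p (λ z∈I → k≰t (≤-trans (∈↑⁻ z∈↑k) (≺⇒≤ (≺t z∈I))))
                   , z∈↑k))))
      where
      -- Shows that `k` is join-irreducible in `L` too: a member of `I` below `k` forces `t ≺ k`, so
      -- it lies below `t`, which lies below `c`.
      c-max′ : ∀ {y} → y ≺ k → y ≤ c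
      c-max′ {y} y≺k with y ∈? I
      ... | no  y∉I = c-max (x∉p⇒x∈∁p y∉I) y≺k
      ... | yes y∈I with up y∈I (≺⇒≤ y≺k)
      ...   | inj₁ k∈I = contradiction k∈I (x∈∁p⇒x∉p k∈)
      ...   | inj₂ t≤k = ≤-trans (≺⇒≤ (≺t y∈I))
              (c-max (x∉p⇒x∈∁p t∉I) (t≤k , λ t≡k → k≰t (≤-reflexive (sym t≡k))))

  -- The smaller lattice `withBounds I b t` is no counterexample, so some join-irreducible has too
  -- small an up-set there. It is not `b`, the least element, nor `t` by assumption, so it lies in
  -- `I` and `noSmallUpset` applies.
  interiorTopReducible⇒⊥ : ∀ {I b t} → IsInterior L I b t → ∣ withBounds I b t ∣ ℕ.< n →
    ¬ (∀ {c} → c ∈ withBounds I b t → c ≺ t →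
        ¬ (∀ {y} → y ∈ withBounds I b t → y ≺ t → y ≤ c))
  interiorTopReducible⇒⊥ {I} {b} {t} interior ∣S∣<n top-reducible =
    noSmallerCounterexample withBounds-closed
      (unique⇒length≤∣p∣ ((proj₂ b≺t ∷ []) ∷ [] ∷ []) (b∈S ∷ t∈S ∷ [])) ∣S∣<n S-large
    where
    open Interior interior
    open ℕₚ.≤-Reasoning

    S = withBounds I b t

    b∈S : b ∈ S
    b∈S = withBounds⁺ (inj₂ (inj₁ refl))

    t∈S : t ∈ S
    t∈S = withBounds⁺ (inj₂ (inj₂ refl))

    S-large : ∀ {c j} → c ∈ S → j ∈ S → c ≺ j → (∀ {y} → y ∈ S → y ≺ j → y ≤ c) →
              ∣ S ∣ ℕ.< 2 ℕ.* ∣ S ∩ ↑ j ∣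
    S-large {c} {j} c∈S j∈S c≺j c-max with withBounds⁻ j∈S
    ... | inj₂ (inj₁ refl) = contradiction (b≤ c∈S) (≺⇒≱ c≺j)
    ... | inj₂ (inj₂ refl) = ⊥-elim (top-reducible c∈S c≺j c-max)
    ... | inj₁ j∈I with ∣ S ∣ ℕₚ.<? 2 ℕ.* ∣ S ∩ ↑ j ∣
    ...   | yes ∣S∣<2∣S∩↑j∣ = ∣S∣<2∣S∩↑j∣
    ...   | no  ∣S∣≮2∣S∩↑j∣ = contradiction
            -- Leaving out `t` shrinks the up-set by one, which doubled makes up for the two
            -- elements `b` and `t` lost from `S`.
            (ℕₚ.+-cancelʳ-≤ 2 _ _ (begin
              2 ℕ.* ∣ I ∩ ↑ j ∣ ℕ.+ 2      ≡⟨ ℕₚ.*-distribˡ-+ 2 ∣ I ∩ ↑ j ∣ 1 ⟨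
              2 ℕ.* (∣ I ∩ ↑ j ∣ ℕ.+ 1)    ≤⟨ ℕₚ.*-monoʳ-≤ 2 t-extra ⟩
              2 ℕ.* ∣ S ∩ ↑ j ∣            ≤⟨ ℕₚ.≮⇒≥ ∣S∣≮2∣S∩↑j∣ ⟩
              ∣ S ∣                        ≤⟨ ∣withBounds∣≤ {I = I} ⟩
              ∣ I ∣ ℕ.+ 2                  ∎))
            (noSmallUpset interior j∈I (c≺j , λ y≺j → [ (λ y∈I → c-max (withBounds⁺ (inj₁ y∈I)) y≺j)
                                                     , (λ y≤b → ≤-trans y≤b (b≤ c∈S)) ]′
                                                     (down j∈I (≺⇒≤ y≺j))))
      where
      t-extra : ∣ I ∩ ↑ j ∣ ℕ.+ 1 ℕ.≤ ∣ S ∩ ↑ j ∣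
      t-extra = subst (λ k → ∣ I ∩ ↑ j ∣ ℕ.+ k ℕ.≤ ∣ S ∩ ↑ j ∣) (∣⁅x⁆∣≡1 t)
        (disjoint⇒∣p∣+∣q∣≤∣r∣
          (λ x∈ → let x∈I , x∈↑j = x∈p∩q⁻ I (↑ j) x∈ in x∈p∩q⁺ (withBounds⁺ (inj₁ x∈I) , x∈↑j))
          (λ x∈ → subst (_∈ S ∩ ↑ j) (sym (x∈⁅y⁆⇒x≡y t x∈)) (x∈p∩q⁺ (t∈S , ∈↑⁺ (≺⇒≤ (≺t j∈I)))))
          (λ x∈ x∈⁅t⁆ → t∉I (subst (_∈ I) (x∈⁅y⁆⇒x≡y t x∈⁅t⁆) (p∩q⊆p I (↑ j) x∈))))

  -- Only the case that `t` has a predecessor `c` in `withBounds I b t` is left. Then `c` is the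
  -- greatest element of `I`, because `I` is nonempty, and `interiorBelow` makes `c` the new top.
  twoElementInterior⇒⊥ : ∀ {I b t} → IsInterior L I b t → 2 ℕ.≤ ∣ I ∣ →
                         ¬ (∣ withBounds I b t ∣ ℕ.< n)
  twoElementInterior⇒⊥ {I} {b} {t} interior 2≤∣I∣ ∣S∣<n =
    interiorTopReducible⇒⊥ interior ∣S∣<n topPredecessor⇒⊥
    where
    open Interior interior

    topPredecessor⇒⊥ : ∀ {c} → c ∈ withBounds I b t → c ≺ t →
      ¬ (∀ {y} → y ∈ withBounds I b t → y ≺ t → y ≤ c)
    topPredecessor⇒⊥ {c} c∈S c≺t c-max with withBounds⁻ c∈S
    ... | inj₂ (inj₂ refl) = ≺⇒≱ c≺t ≤-refl
    ... | inj₂ (inj₁ refl) =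
      let i , i∈I = 0<∣p∣⇒nonempty (ℕₚ.<-≤-trans (s≤s z≤n) 2≤∣I∣)
      in ≺⇒≱ (b≺ i∈I) (c-max (withBounds⁺ (inj₁ i∈I)) (≺t i∈I))
    ... | inj₁ c∈I = interiorTopReducible⇒⊥ belowInterior
      (ℕₚ.≤-<-trans (p⊆q⇒∣p∣≤∣q∣
        (withBounds-⊆ (withBounds⁺ ∘ inj₁ ∘ p∩q⊆p I (∁ ⁅ c ⁆)) (withBounds⁺ (inj₂ (inj₁ refl))) c∈S))
        ∣S∣<n)
      -- If `c` were join-irreducible, `I ∩ ↑ c` would contain `c` alone, which is at most half of
      -- `I`.
      λ a∈S a≺c a-max → noSmallUpset interior c∈I
        (a≺c , λ y≺c → [ (λ y∈I → a-max (withBounds⁺ (inj₁ (x∈p∩q⁺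
                            (y∈I , x∉p⇒x∈∁p (proj₂ y≺c ∘ x∈⁅y⁆⇒x≡y c))))) y≺c)
                       , (λ y≤b → ≤-trans y≤b (Interior.b≤ belowInterior a∈S))
                       ]′ (down c∈I (≺⇒≤ y≺c)))
        (ℕₚ.≤-trans (ℕₚ.*-monoʳ-≤ 2 (p⊆⁅x⁆⇒∣p∣≤1 c λ x∈ →
            let x∈I , x∈↑c = x∈p∩q⁻ I (↑ c) x∈ in antisym (≤c x∈I) (∈↑⁻ x∈↑c)))
          2≤∣I∣)
      where
      ≤c : ∀ {x} → x ∈ I → x ≤ c
      ≤c x∈I = c-max (withBounds⁺ (inj₁ x∈I)) (≺t x∈I)

      belowInterior = interiorBelow c∈I ≤c

  -- The single member `i` has predecessor `b`, and its up-set is covered by `I` and `↑ t`, so it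
  -- has at most 1 + 2 elements, at most half of 6.
  singletonInterior⇒⊥ : ∀ {I b t i} → IsInterior L I b t → ∣ I ∣ ℕ.≤ 1 → i ∈ I →
                        ∣ ↑ t ∣ ℕ.≤ 2 → ¬ (6 ℕ.≤ n)
  singletonInterior⇒⊥ {I} {b} {t} {i} interior ∣I∣≤1 i∈I ∣↑t∣≤2 6≤n = ℕₚ.<⇒≱
    (large (b≺ i∈I , i-atom))
    (ℕₚ.≤-trans (ℕₚ.*-monoʳ-≤ 2 (ℕₚ.≤-trans
      (cover⇒∣r∣≤∣p∣+∣q∣ (Sum.map₂ ∈↑⁺ ∘ up i∈I ∘ ∈↑⁻)) (ℕₚ.+-mono-≤ ∣I∣≤1 ∣↑t∣≤2))) 6≤n)
    where
    open IsInterior interior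

    i-atom : ∀ {y} → y ≺ i → y ≤ b
    i-atom y≺i with down i∈I (≺⇒≤ y≺i)
    ... | inj₂ y≤b = y≤b
    ... | inj₁ y∈I = contradiction
      (unique⇒length≤∣p∣ ((proj₂ y≺i ∷ []) ∷ [] ∷ []) (y∈I ∷ i∈I ∷ [])) (ℕₚ.<⇒≱ (s≤s ∣I∣≤1))

  -- A dual atom d is not join-irreducible, so at least 4 elements lie below it.
  -- A minimal x ≰ d is join-irreducible, and ↑ x avoids those elements.
  atLeastEight : ∀ {b t} → (∀ x → b ≤ x) → (∀ x → x ≤ t) → 4 ℕ.≤ n → ¬ (n ℕ.< 8)
  atLeastEight {b} {t} b-min t-max 4≤n n<8 =
    contradiction n<8 (ℕₚ.≤⇒≯ (ℕₚ.<⇒≤ (ℕₚ.+-cancelʳ-< n _ _ (begin-strict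
      8 ℕ.+ n                              ≡⟨ ℕₚ.+-comm 8 n ⟩
      n ℕ.+ 8                              <⟨ ℕₚ.+-monoˡ-< 8 (large x-irreducible) ⟩
      2 ℕ.* ∣ ↑ x ∣ ℕ.+ 8                  ≡⟨ ℕₚ.*-distribˡ-+ 2 ∣ ↑ x ∣ 4 ⟨
      2 ℕ.* (∣ ↑ x ∣ ℕ.+ 4)                ≤⟨ ℕₚ.*-monoʳ-≤ 2 (ℕₚ.+-monoʳ-≤ ∣ ↑ x ∣ 4≤∣↓d∣) ⟩
      2 ℕ.* (∣ ↑ x ∣ ℕ.+ ∣ Dual.↑ d ∣)     ≤⟨ ℕₚ.*-monoʳ-≤ 2 ∣↑x∣+∣↓d∣≤n ⟩
      2 ℕ.* n                              ≡⟨ cong (n ℕ.+_) (ℕₚ.+-identityʳ n) ⟩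
      n ℕ.+ n                              ∎))))
    where
    open ℕₚ.≤-Reasoning
    module Dual = Order (dual L)

    b≢t : b ≢ t
    b≢t refl = ℕₚ.<⇒≱ (proj₁ (proj₁ minimum)) (subst (ℕ._≤ 1) (∣⊤∣≡n n)
      (p⊆⁅x⁆⇒∣p∣≤1 {p = ⊤} b λ {x} _ → antisym (t-max x) (b-min x)))

    coatom : ∃[ d ] (b ≤ d × t UpperCovers d)
    coatom = lowerCoverAbove (b-min t , b≢t)

    d : Fin n
    d = proj₁ coatom

    t-covers-d : t UpperCovers d
    t-covers-d = proj₂ (proj₂ coatom)

    b≺d : b ≺ d
    b≺d = b-min d , λ b≡d → ℕₚ.<⇒≱ (ℕₚ.≤-trans (s≤s (s≤s (s≤s z≤n))) 4≤n)
      (subst₂ ℕ._≤_ (∣⊤∣≡n n) (∣⁅x⁆∣+∣⁅y⁆∣≡2 d t) (cover⇒∣r∣≤∣p∣+∣q∣ {r = ⊤} λ {x} _ →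
        dualAtom≤ t-max t-covers-d (subst (_≤ x) b≡d (b-min x))))

    -- The up-set of `d` has at most two elements, and twice that is at most `n`.
    d-reducible : ∀ {c} → ¬ IsPredecessor c d
    d-reducible predecessor = ℕₚ.<⇒≱ (large predecessor) (ℕₚ.≤-trans
      (ℕₚ.*-monoʳ-≤ 2 (dualAtom≤⇒∣↑∣≤2 (t , t-max , t-covers-d) ≤-refl)) 4≤n)

    4≤∣↓d∣ : 4 ℕ.≤ ∣ Dual.↑ d ∣
    4≤∣↓d∣ with lowerCoverAbove b≺d
    ... | p , b≤p , p≺d , none with any? (λ q → q ≺? d ×-dec ¬? (q ≤? p))
    ...   | no  p-max             = contradiction
            (p≺d , λ {q} q≺d → decidable-stable (q ≤? p) (λ q≰p → p-max (q , q≺d , q≰p)))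
            d-reducible
    -- The four elements are `b`, `p`, `q` and `d`; if `b` were `p`, then `q` would lie strictly
    -- between `p` and `d`.
    ...   | yes (q , q≺d , q≰p) = unique⇒length≤∣p∣
            ( ((λ { refl → none (q , (b-min q , λ { refl → q≰p ≤-refl }) , q≺d) })
                ∷ (λ { refl → q≰p b≤p }) ∷ proj₂ b≺d ∷ [])
            ∷ ((λ { refl → q≰p ≤-refl }) ∷ proj₂ p≺d ∷ [])
            ∷ (proj₂ q≺d ∷ [])
            ∷ [] ∷ [])
            ( Dual.∈↑⁺ (b-min d) ∷ Dual.∈↑⁺ (≺⇒≤ p≺d) ∷ Dual.∈↑⁺ (≺⇒≤ q≺d) ∷ Dual.∈↑⁺ ≤-refl ∷ [])

    minimal≰d : ∃[ x ] (¬ (x ≤ d) × (∀ {y} → y ≺ x → ¬ ¬ (y ≤ d)))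
    minimal≰d = minimal (λ x → ¬? (x ≤? d)) (≺⇒≱ (proj₁ t-covers-d))

    x : Fin n
    x = proj₁ minimal≰d

    x≰d : ¬ (x ≤ d)
    x≰d = proj₁ (proj₂ minimal≰d)

    -- By minimality everything strictly below `x` is below `d`, hence below `x ∧ d`.
    x-irreducible : IsPredecessor (x ∧ d) x
    x-irreducible = (x∧y≤x x d , λ x∧d≡x → x≰d (subst (_≤ d) x∧d≡x (x∧y≤y x d))) ,
      λ {y} y≺x → ∧-greatest (≺⇒≤ y≺x) (decidable-stable (y ≤? d) (proj₂ (proj₂ minimal≰d) y≺x))

    ∣↑x∣+∣↓d∣≤n : ∣ ↑ x ∣ ℕ.+ ∣ Dual.↑ d ∣ ℕ.≤ n
    ∣↑x∣+∣↓d∣≤n = subst (∣ ↑ x ∣ ℕ.+ ∣ Dual.↑ d ∣ ℕ.≤_) (∣⊤∣≡n n)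
      (disjoint⇒∣p∣+∣q∣≤∣r∣ {r = ⊤} (λ _ → ∈⊤) (λ _ → ∈⊤)
        (λ z∈↑x z∈↓d → x≰d (≤-trans (∈↑⁻ z∈↑x) (Dual.∈↑⁻ z∈↓d))))

  -- The theorem in contrapositive form. With no cover between an inner element and the outside of
  -- `S`, the inner elements form an interior with bounds `b` and `t`, and the size decides which of
  -- the results above applies.
  isolated⇒⊥ : (S : Subset n) {b t : Fin n} → b ∈ S → t ∈ S →
    (∀ {x} → x ∈ S → b ≤ x) → (∀ {x} → x ∈ S → x ≤ t) →
    (∀ {x y} → x ∈ S → x ≢ b → x ≢ t → y ∉ S → ¬ (x UpperCovers y ⊎ x LowerCovers y)) →
    ¬ ( (3 ℕ.< ∣ S ∣ × ∣ S ∣ ℕ.< 8)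
      ⊎ (2 ℕ.< ∣ S ∣ × ∣ S ∣ ℕ.< n ∸ 2 × ∃[ d ] (DualAtom d × d ≤ t)) )
  isolated⇒⊥ S {b} {t} b∈S t∈S b-min t-max isolated = cases
    where
    module Dual = Order (dual L)

    bounds I : Subset n
    bounds = ⁅ b ⁆ ∪ ⁅ t ⁆
    I      = S ∩ ∁ bounds

    ∈I⁺ : ∀ {x} → x ∈ S → x ≢ b → x ≢ t → x ∈ I
    ∈I⁺ x∈S x≢b x≢t = x∈p∩q⁺ (x∈S ,
      x∉p⇒x∈∁p ([ x≢b ∘ x∈⁅y⁆⇒x≡y b , x≢t ∘ x∈⁅y⁆⇒x≡y t ]′ ∘ x∈p∪q⁻ ⁅ b ⁆ ⁅ t ⁆))

    I⊆S : I ⊆ S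
    I⊆S = p∩q⊆p S (∁ bounds)

    ∈I⇒∉bounds : ∀ {x} → x ∈ I → x ∉ bounds
    ∈I⇒∉bounds = x∈∁p⇒x∉p ∘ p∩q⊆q S (∁ bounds)

    ∈I⇒≢b : ∀ {x} → x ∈ I → x ≢ b
    ∈I⇒≢b x∈I refl = ∈I⇒∉bounds x∈I (x∈p∪q⁺ (inj₁ (x∈⁅x⁆ b)))

    ∈I⇒≢t : ∀ {x} → x ∈ I → x ≢ t
    ∈I⇒≢t x∈I refl = ∈I⇒∉bounds x∈I (x∈p∪q⁺ (inj₂ (x∈⁅x⁆ t)))

    -- A lower cover of an inner element stays in `S`, and it is not `t`, which lies above that
    -- inner element.
    stepDown : ∀ {i z} → i ∈ I → i UpperCovers z → z ∈ I ⊎ z ≤ b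
    stepDown {i} {z} i∈I covers with z ∈? S | z ≟ b
    ... | no z∉S  | _ = contradiction (inj₁ covers) (isolated (I⊆S i∈I) (∈I⇒≢b i∈I) (∈I⇒≢t i∈I) z∉S)
    ... | yes _   | yes z≡b = inj₂ (≤-reflexive z≡b)
    ... | yes z∈S | no  z≢b = inj₁ (∈I⁺ z∈S z≢b
          λ { refl → ≺⇒≱ (proj₁ covers) (t-max (I⊆S i∈I)) })

    stepUp : ∀ {i z} → i ∈ I → i LowerCovers z → z ∈ I ⊎ t ≤ z
    stepUp {i} {z} i∈I covers with z ∈? S | z ≟ t
    ... | no z∉S  | _ = contradiction (inj₂ covers) (isolated (I⊆S i∈I) (∈I⇒≢b i∈I) (∈I⇒≢t i∈I) z∉S)
    ... | yes _   | yes z≡t = inj₂ (≤-reflexive (sym z≡t))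
    ... | yes z∈S | no  z≢t = inj₁ (∈I⁺ z∈S
          (λ { refl → ≺⇒≱ (proj₁ covers) (b-min (I⊆S i∈I)) }) z≢t)

    interior : b ≢ t → IsInterior L I b t
    interior b≢t = record
      { b≺t  = b-min t∈S , b≢t
      ; b≺   = λ i∈I → b-min (I⊆S i∈I) , ≢-sym (∈I⇒≢b i∈I)
      ; ≺t   = λ i∈I → t-max (I⊆S i∈I) , ∈I⇒≢t i∈I
      ; up   = Dual.propagateDown (λ i∈I covers → stepUp i∈I (dual-upperCovers {L = L} covers))
      ; down = propagateDown stepDown
      }

    b≢t : 1 ℕ.< ∣ S ∣ → b ≢ t
    b≢t 1<∣S∣ refl = ℕₚ.<⇒≱ 1<∣S∣ (p⊆⁅x⁆⇒∣p∣≤1 b λ x∈S → antisym (t-max x∈S) (b-min x∈S))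

    ∣S∣≤∣I∣+2 : ∣ S ∣ ℕ.≤ ∣ I ∣ ℕ.+ 2
    ∣S∣≤∣I∣+2 = ℕₚ.≤-trans (p⊆q⇒∣p∣≤∣q∣ (λ {x} x∈S → withBounds⁺ (classify x∈S)))
      (∣withBounds∣≤ {I = I} {b} {t})
      where
      classify : ∀ {x} → x ∈ S → x ∈ I ⊎ (x ≡ b ⊎ x ≡ t)
      classify {x} x∈S with x ≟ b | x ≟ t
      ... | yes x≡b | _       = inj₂ (inj₁ x≡b)
      ... | no  _   | yes x≡t = inj₂ (inj₂ x≡t)
      ... | no  x≢b | no  x≢t = inj₁ (∈I⁺ x∈S x≢b x≢t)

    ∣I∣+2≤∣S∣ : b ≢ t → ∣ I ∣ ℕ.+ 2 ℕ.≤ ∣ S ∣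
    ∣I∣+2≤∣S∣ b≢t = ℕₚ.≤-trans
      (ℕₚ.+-monoʳ-≤ ∣ I ∣ (unique⇒length≤∣p∣ {p = bounds} ((b≢t ∷ []) ∷ [] ∷ [])
        (x∈p∪q⁺ (inj₁ (x∈⁅x⁆ b)) ∷ x∈p∪q⁺ (inj₂ (x∈⁅x⁆ t)) ∷ [])))
      (disjoint⇒∣p∣+∣q∣≤∣r∣ I⊆S
        ([ (λ x∈ → subst (_∈ S) (sym (x∈⁅y⁆⇒x≡y b x∈)) b∈S)
         , (λ x∈ → subst (_∈ S) (sym (x∈⁅y⁆⇒x≡y t x∈)) t∈S) ]′ ∘ x∈p∪q⁻ ⁅ b ⁆ ⁅ t ⁆)
        ∈I⇒∉bounds)

    proper⇒⊥ : 3 ℕ.< ∣ S ∣ → ¬ (∣ S ∣ ℕ.< n)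
    proper⇒⊥ 3<∣S∣ ∣S∣<n = twoElementInterior⇒⊥
      (interior (b≢t (ℕₚ.<-trans (s≤s (s≤s z≤n)) 3<∣S∣)))
      (ℕₚ.+-cancelʳ-≤ 2 2 _ (ℕₚ.≤-trans 3<∣S∣ ∣S∣≤∣I∣+2))
      (ℕₚ.≤-<-trans (p⊆q⇒∣p∣≤∣q∣ (withBounds-⊆ I⊆S b∈S t∈S)) ∣S∣<n)

    cases : ¬ ( (3 ℕ.< ∣ S ∣ × ∣ S ∣ ℕ.< 8)
              ⊎ (2 ℕ.< ∣ S ∣ × ∣ S ∣ ℕ.< n ∸ 2 × ∃[ d ] (DualAtom d × d ≤ t)) )
    cases (inj₁ (3<∣S∣ , ∣S∣<8)) with ∣ S ∣ ℕₚ.≟ n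
    ... | no  ∣S∣≢n = proper⇒⊥ 3<∣S∣ (ℕₚ.≤∧≢⇒< (∣p∣≤n S) ∣S∣≢n)
    -- The first size condition allows `S` to be all of `L`; then there is no smaller lattice to use
    -- and the size of `L` itself is contradictory.
    ... | yes ∣S∣≡n = atLeastEight (λ x → b-min (all∈S x)) (λ x → t-max (all∈S x))
          (subst (3 ℕ.<_) ∣S∣≡n 3<∣S∣) (subst (ℕ._< 8) ∣S∣≡n ∣S∣<8)
      where
      all∈S : ∀ x → x ∈ S
      all∈S x = subst (x ∈_) (sym (∣p∣≡n⇒p≡⊤ ∣S∣≡n)) ∈⊤
    cases (inj₂ (2<∣S∣ , ∣S∣<n∸2 , _ , dualAtom , d≤t)) with 3 ℕₚ.<? ∣ S ∣
    ... | yes 3<∣S∣ = proper⇒⊥ 3<∣S∣ (ℕₚ.<-≤-trans ∣S∣<n∸2 (ℕₚ.m∸n≤m n 2))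
    ... | no  3≮∣S∣ = singletonInterior⇒⊥ (interior b≢t′)
          (ℕₚ.+-cancelʳ-≤ 2 _ 1 (ℕₚ.≤-trans (∣I∣+2≤∣S∣ b≢t′) (ℕₚ.≮⇒≥ 3≮∣S∣)))
          (proj₂ I-nonempty) (dualAtom≤⇒∣↑∣≤2 dualAtom d≤t)
          -- From `2 < ∣ S ∣ < n ∸ 2` follows `4 ≤ n ∸ 2`; the subtraction is truncated, so `2≤n` is
          -- needed to conclude `6 ≤ n`.
          (ℕₚ.≤-trans (ℕₚ.+-monoˡ-≤ 2 (ℕₚ.≤-trans (s≤s 2<∣S∣) ∣S∣<n∸2))
            (ℕₚ.≤-reflexive (ℕₚ.m∸n+n≡m {n} {2} 2≤n)))
      where
      b≢t′ : b ≢ t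
      b≢t′ = b≢t (ℕₚ.<-trans (s≤s (s≤s z≤n)) 2<∣S∣)

      I-nonempty : ∃ (_∈ I)
      I-nonempty = 0<∣p∣⇒nonempty (ℕₚ.+-cancelʳ-≤ 2 1 _ (ℕₚ.≤-trans 2<∣S∣ ∣S∣≤∣I∣+2))

      2≤n : 2 ℕ.≤ n
      2≤n = ℕₚ.<⇒≤ (ℕₚ.≤-trans 2<∣S∣ (∣p∣≤n S))

theorem2p15 : ∀ {n : ℕ} (L : FiniteLattice n) → IsMinimumCounterexample L →
    let open FiniteLattice L hiding (_<_) in
    (L′ : Subset n) (_∨′_ _∧′_ : Op₂ (∃ (_∈ L′))) (1′ 0′ : ∃ (_∈ L′)) →
    IsBoundedLatticeOn L′ _∨′_ _∧′_ 1′ 0′ →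
    ( (3 < ∣ L′ ∣ × ∣ L′ ∣ < 8)
    ⊎ (2 < ∣ L′ ∣ × ∣ L′ ∣ < n ∸ 2 × ∃[ d ] (DualAtom d × d ≤ proj₁ 1′)) ) →
    ∃[ x ] ∃[ y ]
    ( x ∈ L′ × x ≢ proj₁ 0′ × x ≢ proj₁ 1′ × y ∉ L′
    × (x UpperCovers y ⊎ x LowerCovers y) )
theorem2p15 L minimum L′ _∨′_ _∧′_ (t , t∈L′) (b , b∈L′) isBounded size
  -- All conditions are decidable on a finite carrier, so a search either finds the pair or refutes
  -- its existence.
  with any? (λ x → any? (λ y → x ∈? L′ ×-dec ¬? (x ≟ b) ×-dec ¬? (x ≟ t) ×-dec ¬? (y ∈? L′)
         ×-dec (x upperCovers? y ⊎-dec y upperCovers? x)))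
  where open Order L
... | yes found = found
... | no  none  = contradiction size (isolated⇒⊥ L′ b∈L′ t∈L′
      (λ x∈L′ → minimum′ (_ , x∈L′)) (λ x∈L′ → maximum (_ , x∈L′))
      (λ x∈L′ x≢b x≢t y∉L′ covers → none (_ , _ , x∈L′ , x≢b , x≢t , y∉L′ , covers)))
  where
  open Minimum L minimum
  open IsBoundedLattice isBounded using (maximum) renaming (minimum to minimum′)
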